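{- Let $T$ be a recurrent tree set of characteristic $1$ on a finite alphabet, closed under reversal. Then $T$ is full.
   Context: Words are over a finite alphabet $A$; $\varepsilon$ is the empty word. A set $S$ of words on $A$ is factorial if it contains $A$ and all the factors of its elements. For $w\in S$ let $L(w)=\{a\in A\mid aw\in S\}$, $R(w)=\{a\in A\mid wa\in S\}$, $B(w)=\{(a,b)\in A\times A\mid awb\in S\}$. A factorial set $S$ is biextendable if $B(w)\neq\emptyset$ for all $w\in S$. The extension graph $\mathcal{E}(w)$ is the undirected graph whose vertex set is the disjoint union of $L(w)$ and $R(w)$ and whose edges are the pairs in $B(w)$. A biextendable set $S$ is a tree set of characteristic $1$ if $\mathcal{E}(w)$ is a tree for every $w\in S$ (including $w=\varepsilon$). A set $S\ne\{\varepsilon\}$ is recurrent if it is factorial and for all $u,w\in S$ there is $v\in S$ with $uvw\in S$. The reversal of $w=a_1a_2\cdots a_n$ is $\tilde w=a_n\cdots a_2a_1$; $w$ is a palindrome if $w=\tilde w$; a set is closed under reversal if it contains the reversal of each of its elements. A word of length $n$ has at most $n+1$ distinct palindrome factors (including $\varepsilon$); it is full if it has exactly $n+1$ palindrome factors. A factorial set is full if all its elements are full. -}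

module Defs where

open import Data.Empty.Polymorphic using (⊥)
open import Data.List.Base using (List; []; _∷_; [_]; _++_; _∷ʳ_; length; reverse)
open import Data.List.Membership.Propositional using (_∈_)
open import Data.List.Relation.Binary.Infix.Heterogeneous using (Infix)
open import Data.List.Relation.Unary.Linked using (Linked)
open import Data.List.Relation.Unary.Unique.Propositional using (Unique)
open import Data.Nat.Base using (suc; _≤_)
open import Data.Product.Base using (∃-syntax; _×_)
open import Data.Sum.Base using (_⊎_; inj₁; inj₂)
open import Function.Bundles using (_⇔_)
open import Level using (Level; _⊔_)
open import Relation.Binary.Construct.Closure.ReflexiveTransitive using (Star)
open import Relation.Binary.Core using (Rel)
open import Relation.Binary.PropositionalEquality.Core using (_≡_)
open import Relation.Nullary.Negation.Core using (¬_)
open import Relation.Unary using (Pred; _≐_; ｛_｝)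

private
  variable
    a ℓ : Level

-- Vertices form a subset of an ambient type, so that two vertices are
-- compared as elements of V, regardless of their membership proofs.
record Graph (V : Set a) (ℓ : Level) : Set (a ⊔ Level.suc ℓ) where
  field
    Vertex : Pred V ℓ
    Edge   : Rel V ℓ

module _ {V : Set a} (G : Graph V ℓ) where
  open Graph G

  Connected : Set (a ⊔ ℓ)
  Connected = ∀ {x y} → Vertex x → Vertex y → Star Edge x y

  -- x ∷ ys lists the distinct vertices of the cycle, of which there are
  -- at least three.
  Cycle : V → List V → Set (a ⊔ ℓ)
  Cycle x ys = 2 ≤ length ys × Unique (x ∷ ys) × Linked Edge (x ∷ ys ++ [ x ])

  Acyclic : Set (a ⊔ ℓ)
  Acyclic = ∀ {x ys} → ¬ Cycle x ys

  IsTree : Set (a ⊔ ℓ)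
  IsTree = Connected × Acyclic

module _ {A : Set a} where

  Factor : Rel (List A) a
  Factor = Infix _≡_

  Palindrome : Pred (List A) a
  Palindrome w = w ≡ reverse w

  -- The list ps enumerates the palindrome factors of w (the empty word
  -- included) without repetition.
  FullWord : Pred (List A) a
  FullWord w = ∃[ ps ] Unique ps
                     × (∀ p → p ∈ ps ⇔ (Factor p w × Palindrome p))
                     × length ps ≡ suc (length w)

module _ {A : Set a} (S : Pred (List A) ℓ) where

  Factorial : Set (a ⊔ ℓ)
  Factorial = (∀ x → S [ x ]) × (∀ {u w} → Factor u w → S w → S u)

  L : List A → Pred A ℓ
  L w x = S (x ∷ w)

  R : List A → Pred A ℓ
  R w y = S (w ∷ʳ y)

  B : List A → A → A → Set ℓ
  B w x y = S (x ∷ w ∷ʳ y)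

  Biextendable : Set (a ⊔ ℓ)
  Biextendable = Factorial × (∀ {w} → S w → ∃[ x ] ∃[ y ] B w x y)

  -- The disjoint union of L w and R w, as a subset of A ⊎ A. The edges are
  -- the pairs of B w, in both orientations; when S is factorial, their
  -- endpoints are vertices.
  extensionGraph : List A → Graph (A ⊎ A) ℓ
  extensionGraph w = record { Vertex = Vertex ; Edge = Edge }
    where
    Vertex : Pred (A ⊎ A) ℓ
    Vertex (inj₁ x) = L w x
    Vertex (inj₂ y) = R w y

    Edge : Rel (A ⊎ A) ℓ
    Edge (inj₁ x) (inj₂ y) = B w x y
    Edge (inj₂ y) (inj₁ x) = B w x y
    Edge (inj₁ _) (inj₁ _) = ⊥
    Edge (inj₂ _) (inj₂ _) = ⊥

  -- Tree sets of characteristic 1: the empty word is not exempted.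
  TreeSet₁ : Set (a ⊔ ℓ)
  TreeSet₁ = Biextendable × (∀ {w} → S w → IsTree (extensionGraph w))

  Recurrent : Set (a ⊔ ℓ)
  Recurrent = ¬ (S ≐ ｛ [] ｝)
            × Factorial
            × (∀ {u w} → S u → S w → ∃[ v ] S v × S (u ++ v ++ w))

  ClosedUnderReversal : Set (a ⊔ ℓ)
  ClosedUnderReversal = ∀ {w} → S w → S (reverse w)

  FullSet : Set (a ⊔ ℓ)
  FullSet = Factorial × (∀ {w} → S w → FullWord w)

{-# OPTIONS --safe #-}

-- Let w̃ be the reversal of w. The heart of the proof is: if a word of T
-- starts with wb (b a letter) and contains a further occurrence of w or w̃,
-- then bw̃ occurs in it, ending no later than that occurrence. This goes by
-- induction on |w|. For aw, the induction hypothesis says that the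
-- successive occurrences of w and w̃ in a word starting with awb alternate
-- as awb…bw̃c…cwd…dw̃…, so that a, b, c, d, … is a walk in the extension
-- graph of w, from the left vertex a. Followed up to the first occurrence
-- of w̃a, it is a closed walk in an acyclic graph, hence its first and last
-- edges agree and w̃a is preceded by b. (If w is a palindrome the walk may
-- end in the right vertex a; append then its mirror image.)
--
-- Applying this to w, wb, wbb′, … gives: a prefix w of a word v ∈ T which
-- occurs again in v is shorter than some palindromic prefix of v. So v = xu
-- has a palindromic prefix that is not a factor of u; as shorter palindromic
-- prefixes are suffixes of longer ones, it is the only palindromic factor
-- of v not in u.
module Submission where

open import Defs
open import Data.Bool.Base using (Bool; true; false; not)
open import Data.Empty using (⊥-elim)
open import Data.Fin.Base using (Fin)
import Data.Fin.Properties as Fin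
open import Data.List.Base using (List; []; _∷_; [_]; _++_; _∷ʳ_; length; reverse)
open import Data.List.Membership.Propositional using (_∈_)
import Data.List.Membership.DecPropositional as DecMembership
open import Data.List.Properties using (++-assoc; ++-identityʳ; length-++; length-reverse; reverse-++; reverse-involutive; unfold-reverse; ∷-injective; ∷ʳ-injective)
import Data.List.Properties as List
open import Data.List.Relation.Binary.Infix.Heterogeneous using (here; there; toView; fromView; MkView)
open import Data.List.Relation.Binary.Infix.Heterogeneous.Properties using (infix?; ∷⁻)
import Data.List.Relation.Binary.Pointwise as Pointwise
import Data.List.Relation.Binary.Prefix.Heterogeneous as Prefix
open import Data.List.Relation.Unary.All as All using (All; []; _∷_)
open import Data.List.Relation.Unary.All.Properties using (¬Any⇒All¬)
open import Data.List.Relation.Unary.AllPairs using ([]; _∷_)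
open import Data.List.Relation.Unary.Any using (here; there)
open import Data.List.Relation.Unary.Linked using (Linked; [-]; _∷_)
open import Data.List.Relation.Unary.Unique.Propositional using (Unique)
open import Data.Nat.Base using (ℕ; zero; suc; _+_; _≤_; _<_; z≤n; s≤s; s≤s⁻¹)
open import Data.Nat.Properties using (suc-injective; ≤-refl; ≤-trans; ≤-reflexive; <⇒≤; <-cmp; <-irrefl; <⇒≢; +-comm; +-monoʳ-<; m≤m+n; m≤n+m; module ≤-Reasoning)
open import Data.Product.Base using (∃-syntax; _×_; _,_; proj₁; proj₂)
open import Data.Sum.Base using (_⊎_; inj₁; inj₂; swap)
open import Data.Sum.Properties using (inj₂-injective)
import Data.Sum.Properties as Sum
open import Function.Base using (_∘_)
open import Function.Bundles using (_↔_; mk⇔; module Equivalence)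
open import Function.Properties.Inverse using (↔⇒↣)
open import Level using (Level; _⊔_)
open import Relation.Binary.Construct.Closure.ReflexiveTransitive using (Star; ε; _◅_; _◅◅_; gmap)
import Relation.Binary.Construct.Closure.ReflexiveTransitive as Star
open import Relation.Binary.Definitions using (DecidableEquality; tri<; tri≈; tri>)
open import Relation.Binary.PropositionalEquality using (_≡_; _≢_; refl; sym; trans; cong; cong₂; subst; module ≡-Reasoning)
open import Relation.Nullary.Decidable using (yes; no; via-injection)
open import Relation.Nullary.Negation using (¬_; contradiction)
open import Relation.Unary using (Pred)

private
  variable
    a ℓ p : Level

-- Words, occurrences and palindromes

module _ {A : Set a} where

  -- Levi's lemma, in the case where `p` is the shorter left part.
  ++-split : ∀ (p t : List A) {q s} → p ++ q ≡ t ++ s → length p ≤ length t →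
             ∃[ m ] t ≡ p ++ m × q ≡ m ++ s
  ++-split []      t       eq _         = t , refl , eq
  ++-split (x ∷ p) (y ∷ t) eq (s≤s p≤t) with refl , eq′ ← ∷-injective eq
                                        with m , refl , q≡ ← ++-split p t eq′ p≤t = m , refl , q≡

  ++-injective : ∀ (p t : List A) {q s} → p ++ q ≡ t ++ s → length p ≡ length t →
                 p ≡ t × q ≡ s
  ++-injective []      []      eq _   = refl , eq
  ++-injective (x ∷ p) (y ∷ t) eq p≡t with refl , eq′ ← ∷-injective eq
                                      with refl , q≡s ← ++-injective p t eq′ (suc-injective p≡t) = refl , q≡s

  laterOccurrence⇒longer : ∀ (t z : List A) {r v} → v ≡ t ++ z ++ r → 0 < length t → length z < length v
  laterOccurrence⇒longer (y ∷ t) z {r} refl _ = s≤s (begin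
    length z                    ≤⟨ m≤m+n (length z) (length r) ⟩
    length z + length r         ≡⟨ length-++ z ⟨
    length (z ++ r)             ≤⟨ m≤n+m (length (z ++ r)) (length t) ⟩
    length t + length (z ++ r)  ≡⟨ length-++ t ⟨
    length (t ++ z ++ r)        ∎)
    where open ≤-Reasoning

  properPrefix⇒nonempty : ∀ (p m : List A) → length p < length (p ++ m) → 0 < length m
  properPrefix⇒nonempty p []      p<p = contradiction (cong length (sym (++-identityʳ p))) (<⇒≢ p<p)
  properPrefix⇒nonempty p (_ ∷ _) _   = s≤s z≤n

  length-∷ʳ : ∀ (w : List A) x → length (w ∷ʳ x) ≡ suc (length w)
  length-∷ʳ w x = trans (length-++ w) (+-comm (length w) 1)

  reverse-∷-++ : ∀ (x : A) w s → reverse (x ∷ w) ++ s ≡ reverse w ++ x ∷ s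
  reverse-∷-++ x w s = trans (cong (_++ s) (unfold-reverse x w)) (++-assoc (reverse w) [ x ] s)

  factor-++ : ∀ (t : List A) {u} r → Factor u (t ++ u ++ r)
  factor-++ t r = fromView (MkView t (Pointwise.refl refl) r)

  suffix⇒factor : ∀ t {u : List A} → Factor u (t ++ u)
  suffix⇒factor t {u} = subst (Factor u) (cong (t ++_) (++-identityʳ u)) (factor-++ t [])

  factor⁻ : ∀ {u v : List A} → Factor u v → ∃[ t ] ∃[ r ] v ≡ t ++ u ++ r
  factor⁻ f with MkView t u≋ r ← toView f with refl ← Pointwise.Pointwise-≡⇒≡ u≋ = t , r , refl

  prefix⁻ : ∀ {u v : List A} → Prefix.Prefix _≡_ u v → ∃[ r ] v ≡ u ++ r
  prefix⁻ f with u≋ Prefix.++ r ← Prefix.toView f with refl ← Pointwise.Pointwise-≡⇒≡ u≋ = r , refl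

  orient : Bool → List A → List A
  orient false w = w
  orient true  w = reverse w

  orient-not : ∀ s w → orient (not s) w ≡ reverse (orient s w)
  orient-not false w = refl
  orient-not true  w = sym (reverse-involutive w)

  length-orient : ∀ s w → length (orient s w) ≡ length w
  length-orient false w = refl
  length-orient true  w = length-reverse w

  orient-reorient : ∀ d s w → ∃[ e ] orient d w ≡ orient e (orient s w)
  orient-reorient d     false w = d , refl
  orient-reorient true  true  w = false , refl
  orient-reorient false true  w = true , sym (reverse-involutive w)

  palindromicPrefix⇒suffix : ∀ {p : List A} q {m} → Palindrome p → Palindrome q →
                             p ≡ q ++ m → p ≡ reverse m ++ q
  palindromicPrefix⇒suffix {p} q {m} pal-p pal-q p≡ = begin
    p                       ≡⟨ pal-p ⟩
    reverse p               ≡⟨ cong reverse p≡ ⟩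
    reverse (q ++ m)        ≡⟨ reverse-++ q m ⟩
    reverse m ++ reverse q  ≡⟨ cong (reverse m ++_) pal-q ⟨
    reverse m ++ q          ∎
    where open ≡-Reasoning

  -- Reflected in `p`, the prefix `q` becomes a suffix of `p`; being shorter than `p`, this
  -- occurrence starts after `x`.
  shorterPalindromicPrefix⇒factor :
    ∀ {x u} {p q r s : List A} → Palindrome p → Palindrome q →
    x ∷ u ≡ p ++ r → x ∷ u ≡ q ++ s → length q < length p → Factor q u
  shorterPalindromicPrefix⇒factor {x} {u} {p} {q} {r} {s} pal-p pal-q v≡pr v≡qs q<p
    with m , p≡ , _ ← ++-split q p {s} {r} (trans (sym v≡qs) v≡pr) (<⇒≤ q<p)
    = suffix (reverse m) (palindromicPrefix⇒suffix q pal-p pal-q p≡) v≡pr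
    where
    suffix : ∀ t → p ≡ t ++ q → x ∷ u ≡ p ++ r → Factor q u
    suffix []      refl _    = contradiction q<p (<-irrefl refl)
    suffix (_ ∷ t) refl refl = subst (Factor q) (sym (++-assoc t q r)) (factor-++ t r)

-- Paths and first returns in acyclic graphs

module _ {V : Set a} (_≟_ : DecidableEquality V) (G : Graph V ℓ) where
  open Graph G
  open DecMembership _≟_ using (_∈?_)

  data Path : V → V → List V → Set (a ⊔ ℓ) where
    stop : ∀ {x} → Path x x [ x ]
    step : ∀ {x y z ys} → Edge x y → Path y z ys → Path x z (x ∷ ys)

  SimplePath : Pred V p → V → V → Set (a ⊔ ℓ ⊔ p)
  SimplePath P x z = ∃[ ys ] Path x z ys × Unique ys × All P ys

  dropTo : ∀ {P : Pred V p} {x y z ys} → y ∈ ys → Path x z ys → Unique ys → All P ys → SimplePath P y z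
  dropTo (here refl)  stop          u       ps       = _ , stop , u , ps
  dropTo (here refl)  (step e path) u       ps       = _ , step e path , u , ps
  dropTo (there y∈ys) (step e path) (_ ∷ u) (_ ∷ ps) = dropTo y∈ys path u ps

  eraseLoops : ∀ {P : Pred V p} {x z} → P x → Star (λ u v → Edge u v × P v) x z → SimplePath P x z
  eraseLoops px ε = _ , stop , [] ∷ [] , px ∷ []
  eraseLoops {x = x} px ((e , py) ◅ es) with ys , path , u , ps ← eraseLoops py es
                                        with x ∈? ys
  ... | yes x∈ys = dropTo x∈ys path u ps
  ... | no  x∉ys = x ∷ ys , step e path , ¬Any⇒All¬ ys x∉ys ∷ u , px ∷ ps

  path⇒linked : ∀ {x y z t ys} → Edge x y → Path y z ys → Edge z t → Linked Edge (x ∷ ys ++ [ t ])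
  path⇒linked e stop           f = e ∷ f ∷ [-]
  path⇒linked e (step e′ path) f = e ∷ path⇒linked e′ path f

  path-length : ∀ {y z ys} → y ≢ z → Path y z ys → 2 ≤ length ys
  path-length y≢z stop                = contradiction refl y≢z
  path-length y≢z (step _ stop)       = s≤s (s≤s z≤n)
  path-length y≢z (step _ (step _ _)) = s≤s (s≤s z≤n)

  -- Loop erasure turns the walk into a simple path that still avoids `x`. If `y` and `z` differ,
  -- the two edges at `x` close it to a cycle of at least three vertices.
  acyclic⇒firstReturn : Acyclic G → ∀ {x y z} → Edge x y → x ≢ y →
                        Star (λ u v → Edge u v × x ≢ v) y z → Edge z x → y ≡ z
  acyclic⇒firstReturn acyclic {x} {y} {z} e x≢y walk f with y ≟ z
  ... | yes y≡z = y≡z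
  ... | no  y≢z with ys , path , u , x∉ys ← eraseLoops {P = x ≢_} x≢y walk =
    ⊥-elim (acyclic (path-length y≢z path , x∉ys ∷ u , path⇒linked e path f))

-- First returns in a reversal-closed set with acyclic extension graphs

module _ {A : Set a} (_≟_ : DecidableEquality A) (T : Pred (List A) ℓ)
         (factorial : ∀ {u w} → Factor u w → T w → T u)
         (reversal  : ClosedUnderReversal T)
         (acyclic   : ∀ {w} → T w → Acyclic (extensionGraph T w))
         where

  private
    _≟ʷ_ : DecidableEquality (List A)
    _≟ʷ_ = List.≡-dec _≟_

  reverseExtension : ∀ {x w y} → T (x ∷ w ∷ʳ y) → T (y ∷ reverse w ∷ʳ x)
  reverseExtension {x} {w} {y} t =
    subst T (trans (reverse-++ (x ∷ w) [ y ]) (cong (y ∷_) (unfold-reverse x w))) (reversal t)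

  -- The word `b ∷ reverse w` is one letter longer than `orient d w`, so ending no later than that
  -- occurrence means starting strictly before it.
  FirstReturn : List A → Set (a ⊔ ℓ)
  FirstReturn w = ∀ b s → T (w ++ b ∷ s) → ∀ d t r → w ++ b ∷ s ≡ t ++ orient d w ++ r → 0 < length t →
                  ∃[ t′ ] ∃[ r′ ] w ++ b ∷ s ≡ t′ ++ b ∷ reverse w ++ r′ × length t′ < length t

  -- The induction step: walks in the extension graph of `w`

  module _ (x₀ : A) (w : List A) (firstReturn : ∀ s → FirstReturn (orient s w)) where
    open Graph (extensionGraph T w) using (Edge)

    -- In a factor xyc with y = orient s w, the letter x stands for the vertex
    -- vertex s x and c for vertex (not s) c.
    vertex : Bool → A → A ⊎ A
    vertex false = inj₁
    vertex true  = inj₂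

    edge : ∀ s {x c r} → T (x ∷ orient s w ++ c ∷ r) → Edge (vertex s x) (vertex (not s) c)
    edge s {x} {c} {r} Tv = orientEdge s (factorial (subst (Factor _) v≡ (factor-++ [] r)) Tv)
      where
      v≡ : (x ∷ orient s w ∷ʳ c) ++ r ≡ x ∷ orient s w ++ c ∷ r
      v≡ = cong (x ∷_) (++-assoc (orient s w) [ c ] r)

      orientEdge : ∀ s → T (x ∷ orient s w ∷ʳ c) → Edge (vertex s x) (vertex (not s) c)
      orientEdge false xwc = xwc
      orientEdge true  xwc = subst (λ v → T (c ∷ v ∷ʳ x)) (reverse-involutive w) (reverseExtension xwc)

    -- An equality of words rather than of orientations: when `w` is a palindrome, either
    -- orientation may end the walk.
    Closing : Bool → A → Set a
    Closing s c = orient s w ∷ʳ c ≡ reverse w ∷ʳ x₀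

    -- The second condition makes the mirror image of the walk, available when `w` is a palindrome,
    -- avoid `inj₁ x₀` too.
    Avoids : A ⊎ A → Set a
    Avoids v = inj₁ x₀ ≢ v × (Palindrome w → inj₂ x₀ ≢ v)

    ¬closing⇒avoids : ∀ s {c} → ¬ Closing s c → Avoids (vertex (not s) c)
    ¬closing⇒avoids false ¬closing = (λ ()) , λ { pal refl → ¬closing (cong (_∷ʳ x₀) pal) }
    ¬closing⇒avoids true  ¬closing = (λ { refl → ¬closing refl }) , λ _ ()

    Walk : A ⊎ A → A ⊎ A → Set (a ⊔ ℓ)
    Walk = Star (λ u v → Edge u v × Avoids v)

    -- The walk read off a word v = xyc… with y = orient s w, from the vertex of c
    -- to the letter before the first occurrence of w̃x₀.
    record Closure (s : Bool) (c : A) (v : List A) (n : ℕ) : Set (a ⊔ ℓ) where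
      constructor closure
      field
        {side}      : Bool
        {end}       : A
        walk        : Walk (vertex (not s) c) (vertex side end)
        lastEdge    : Edge (vertex side end) (vertex (not side) x₀)
        closing     : Closing side x₀
        before rest : List A
        occurs      : v ≡ before ++ end ∷ reverse w ++ x₀ ∷ rest
        early       : length before < n

    shift : ∀ {s s′ c c′ v v′ n n′} (t : List A) → v ≡ t ++ v′ → n ≡ length t + n′ →
            (∀ {z} → Walk (vertex (not s′) c′) z → Walk (vertex (not s) c) z) →
            Closure s′ c′ v′ n′ → Closure s c v n
    shift t refl refl extend (closure walk last closing before rest refl early) =
      closure (extend walk) last closing (t ++ before) rest
        (sym (++-assoc t before _))
        (subst (_< _) (sym (length-++ t)) (+-monoʳ-< (length t) early))

    -- One step of the walk, from `orient s w` to a later occurrence of its reversal, preceded by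
    -- `c`. The target, a given occurrence of `x₀ ∷ w` or its reversal, starts strictly after this
    -- `c`, by `nonempty`.
    record NextOccurrence (s : Bool) (x c : A) (r : List A) (d : Bool) (t r₂ : List A) : Set a where
      constructor next
      field
        skipped remaining : List A
        {letter} : A
        {rest}   : List A
        split    : x ∷ orient s w ++ c ∷ r ≡ (x ∷ skipped) ++ c ∷ orient (not s) w ++ letter ∷ rest
        target   : c ∷ orient (not s) w ++ letter ∷ rest ≡ remaining ++ orient d (x₀ ∷ w) ++ r₂
        position : t ≡ (x ∷ skipped) ++ remaining
        nonempty : 0 < length remaining

    nextOccurrence : ∀ s x c r → T (x ∷ orient s w ++ c ∷ r) → ¬ Closing s c →
                     ∀ d t r₂ → x ∷ orient s w ++ c ∷ r ≡ t ++ orient d (x₀ ∷ w) ++ r₂ → 0 < length t →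
                     NextOccurrence s x c r d t r₂
    nextOccurrence s x c r Tv ¬closing d (y ∷ t₀) r₂ eq _ with refl , eq′ ← ∷-injective eq = go d eq′
      where
      y≡ : orient (not s) w ≡ reverse (orient s w)
      y≡ = orient-not s w

      Ty : T (orient s w ++ c ∷ r)
      Ty = factorial (suffix⇒factor [ x ]) Tv

      open ≡-Reasoning

      finish : ∀ d t′ r′ m → orient s w ++ c ∷ r ≡ t′ ++ c ∷ reverse (orient s w) ++ r′ →
               x ∷ t₀ ≡ (x ∷ t′) ++ m → c ∷ reverse (orient s w) ++ r′ ≡ m ++ orient d (x₀ ∷ w) ++ r₂ →
               0 < length m → NextOccurrence s x c r d (x ∷ t₀) r₂
      -- Here `c ∷ reverse (orient s w)` would end the word, but the target is equally long and
      -- starts later.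
      finish d t′ [] m split position target 0<m =
        contradiction (laterOccurrence⇒longer m (orient d (x₀ ∷ w)) target 0<m) (<-irrefl lengths)
        where
        lengths : length (orient d (x₀ ∷ w)) ≡ length (c ∷ reverse (orient s w) ++ [])
        lengths = begin
          length (orient d (x₀ ∷ w))                 ≡⟨ length-orient d (x₀ ∷ w) ⟩
          suc (length w)                             ≡⟨ cong suc (length-orient s w) ⟨
          suc (length (orient s w))                  ≡⟨ cong suc (length-reverse (orient s w)) ⟨
          suc (length (reverse (orient s w)))        ≡⟨ cong (suc ∘ length) (++-identityʳ (reverse (orient s w))) ⟨
          suc (length (reverse (orient s w) ++ []))  ∎
      finish d t′ (e ∷ r′) m split position target 0<m = next t′ m
        (cong (x ∷_) (trans split (cong (λ v → t′ ++ c ∷ v ++ e ∷ r′) (sym y≡))))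
        (trans (cong (λ v → c ∷ v ++ e ∷ r′) y≡) target) position 0<m

      go : ∀ d → orient s w ++ c ∷ r ≡ t₀ ++ orient d (x₀ ∷ w) ++ r₂ → NextOccurrence s x c r d (x ∷ t₀) r₂
      go true eq′ = goʳ t₀ refl
        where
        eq″ : orient s w ++ c ∷ r ≡ t₀ ++ reverse w ++ x₀ ∷ r₂
        eq″ = trans eq′ (cong (t₀ ++_) (reverse-∷-++ x₀ w r₂))
        goʳ : ∀ t → t ≡ t₀ → NextOccurrence s x c r true (x ∷ t₀) r₂
        -- A target right after `x` would be `orient s w ∷ʳ c` itself, which is not closing.
        goʳ [] refl
          with y≡w , cr≡ ← ++-injective (orient s w) (reverse w) eq″
                 (trans (length-orient s w) (sym (length-reverse w)))
          = contradiction (cong₂ _∷ʳ_ y≡w (proj₁ (∷-injective cr≡))) ¬closing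
        goʳ (_ ∷ t₁) refl
          with e , w≡ ← orient-reorient true s w
          with t′ , r′ , split , t′<t₀ ← firstReturn s c r Ty e t₀ (x₀ ∷ r₂)
                 (trans eq″ (cong (λ v → t₀ ++ v ++ x₀ ∷ r₂) w≡)) (s≤s z≤n)
          with m , position , target ← ++-split t′ t₀ (trans (sym split) eq′) (<⇒≤ t′<t₀)
          = finish true t′ r′ m split (cong (x ∷_) position) target
              (properPrefix⇒nonempty t′ m (subst (length t′ <_) (cong length position) t′<t₀))
      -- The `w` inside `x₀ ∷ w` starts one letter later, so the strict bound only makes `t′` at
      -- most as long as `t₀`.
      go false eq′
        with e , w≡ ← orient-reorient false s w
        with t′ , r′ , split , t′<t₀ ← firstReturn s c r Ty e (t₀ ∷ʳ x₀) r₂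
               (trans eq′ (trans (sym (++-assoc t₀ [ x₀ ] (w ++ r₂)))
                 (cong (λ v → (t₀ ∷ʳ x₀) ++ v ++ r₂) w≡)))
               (subst (0 <_) (sym (length-∷ʳ t₀ x₀)) (s≤s z≤n))
        with ++-split t′ t₀ (trans (sym split) eq′) (s≤s⁻¹ (≤-trans t′<t₀ (≤-reflexive (length-∷ʳ t₀ x₀))))
      ... | m@(_ ∷ _) , position , target = finish false t′ r′ m split (cong (x ∷_) position) target (s≤s z≤n)
      -- Equal lengths make `c ∷ reverse (orient s w)` the target `x₀ ∷ w`, so `orient s w ∷ʳ c`
      -- would be closing.
      ... | []        , position , target
        with refl , yr≡ ← ∷-injective target
        with ỹ≡w , _ ← ++-injective (reverse (orient s w)) w yr≡
               (trans (length-reverse (orient s w)) (length-orient s w))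
        = contradiction
            (cong (_∷ʳ x₀) (trans (sym (reverse-involutive (orient s w))) (cong reverse ỹ≡w)))
            ¬closing

    -- Every step shortens the distance `length t` to the target but never reaches it, so a closing
    -- word must turn up first; `n` bounds that distance.
    followWalk : ∀ n s x c r → T (x ∷ orient s w ++ c ∷ r) → ¬ Closing s c →
                 ∀ d t r₂ → x ∷ orient s w ++ c ∷ r ≡ t ++ orient d (x₀ ∷ w) ++ r₂ →
                 0 < length t → length t ≤ n →
                 Closure s c (x ∷ orient s w ++ c ∷ r) (length t)
    followWalk zero s x c r Tv ¬closing d t r₂ eq 0<t t≤n = contradiction (≤-trans 0<t t≤n) λ ()
    followWalk (suc n) s x c r Tv ¬closing d t r₂ eq 0<t t≤n
      with next t′ m {e} {r′} split target position 0<m ← nextOccurrence s x c r Tv ¬closing d t r₂ eq 0<t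
      with Tv′ ← factorial (subst (Factor _) (sym split) (suffix⇒factor (x ∷ t′))) Tv
      with t≡ ← trans (cong length position) (length-++ (x ∷ t′))
      with (orient (not s) w ∷ʳ e) ≟ʷ (reverse w ∷ʳ x₀)
    ... | no ¬closing′ = shift (x ∷ t′) split t≡
            ((edge (not s) Tv′ , ¬closing⇒avoids (not s) ¬closing′) ◅_)
            (followWalk n (not s) c e r′ Tv′ ¬closing′ d m r₂ target 0<m
              (s≤s⁻¹ (≤-trans (s≤s (m≤n+m (length m) (length t′))) (subst (_≤ suc n) t≡ t≤n))))
    ... | yes closing with y≡ , refl ← ∷ʳ-injective (orient (not s) w) (reverse w) closing =
            shift {s′ = s} {c′ = c} (x ∷ t′) split t≡
              (λ walk → walk)
              (closure ε (edge (not s) Tv′) closing [] r′ (cong (λ v → c ∷ v ++ x₀ ∷ r′) y≡) 0<m)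

    flipEdge : Palindrome w → ∀ {u v} → Edge u v → Edge (swap u) (swap v)
    flipEdge pal {inj₁ x} {inj₂ y} t = subst (λ v → T (y ∷ v ∷ʳ x)) (sym pal) (reverseExtension t)
    flipEdge pal {inj₂ y} {inj₁ x} t = flipEdge pal {inj₁ x} {inj₂ y} t

    flipAvoids : Palindrome w → ∀ {v} → Avoids v → inj₁ x₀ ≢ swap v
    flipAvoids pal {inj₂ _} (_ , x₀≢) refl = x₀≢ pal refl

    closedWalk⇒≡ : T w → ∀ {b e} s → T (x₀ ∷ w ∷ʳ b) → ¬ Closing false b →
                   Walk (inj₂ b) (vertex s e) → Edge (vertex s e) (vertex (not s) x₀) →
                   Closing s x₀ → b ≡ e
    closedWalk⇒≡ Tw true first ¬closing walk last _ =
      inj₂-injective (acyclic⇒firstReturn (Sum.≡-dec _≟_ _≟_) (extensionGraph T w) (acyclic Tw) first (λ ())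
        (Star.map (λ (e , avoids) → e , proj₁ avoids) walk) last)
    -- The closed walk runs from left `x₀` through right `b` to left `e` and right `x₀`, then
    -- through the mirror images, left `b` to right `e`, back to left `x₀`.
    closedWalk⇒≡ Tw {b} {e} false first ¬closing walk last closing =
      inj₂-injective (acyclic⇒firstReturn (Sum.≡-dec _≟_ _≟_) (extensionGraph T w) (acyclic Tw) first (λ ())
        (Star.map (λ (e , avoids) → e , proj₁ avoids) walk
          ◅◅ _◅_ {j = inj₂ x₀} (last , λ ()) ((flipEdge pal {inj₁ x₀} {inj₂ b} first ,
              flipAvoids pal (¬closing⇒avoids false ¬closing))
          ◅ gmap swap (λ {u} {v} (e , avoids) → flipEdge pal {u} {v} e , flipAvoids pal avoids) walk))
        (flipEdge pal {inj₁ e} {inj₂ x₀} last))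
      where
      pal : Palindrome w
      pal = proj₁ (∷ʳ-injective w (reverse w) closing)

    firstReturn-∷ : FirstReturn (x₀ ∷ w)
    firstReturn-∷ b s Tv d t r eq 0<t with (w ∷ʳ b) ≟ʷ (reverse w ∷ʳ x₀)
    -- Here `w` is a palindrome and `b` is `x₀`, so the prefix `x₀ ∷ w ∷ʳ x₀` is the required
    -- occurrence.
    ... | yes closing with pal , refl ← ∷ʳ-injective w (reverse w) closing =
      [] , s , cong (x₀ ∷_) (trans (cong (_++ x₀ ∷ s) pal) (sym (reverse-∷-++ x₀ w s))) , 0<t
    ... | no ¬closing
      with closure {side} walk last closing t′ r′ occurs t′<t ←
             followWalk (length t) false x₀ b s Tv ¬closing d t r eq 0<t ≤-refl
      with refl ←
             closedWalk⇒≡ (factorial (factor-++ [ x₀ ] (b ∷ s)) Tv) side (edge false Tv) ¬closing walk last closing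
      = t′ , r′ , trans occurs (cong (λ v → t′ ++ b ∷ v) (sym (reverse-∷-++ x₀ w r′))) , t′<t

  -- Induction on the length, since the hypothesis is also needed for the reversal of the tail,
  -- which is not a subterm.
  firstReturn : ∀ n w → length w ≡ n → FirstReturn w
  firstReturn zero    []      _   b s Tv d t r eq 0<t = [] , s , refl , 0<t
  firstReturn (suc n) (x ∷ w) w≡n = firstReturn-∷ x w λ s →
    firstReturn n (orient s w) (trans (length-orient s w) (suc-injective w≡n))

  -- Palindromic prefixes and fullness

  longerPalindromicPrefix : ∀ w r → T (w ++ r) → ∀ d t r₂ → w ++ r ≡ t ++ orient d w ++ r₂ → 0 < length t →
                            ∃[ p ] ∃[ q ] w ++ r ≡ p ++ q × Palindrome p × length w < length p
  longerPalindromicPrefix w [] Tv d t r₂ eq 0<t =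
    contradiction (laterOccurrence⇒longer t (orient d w) eq 0<t)
      (<-irrefl (trans (length-orient d w) (cong length (sym (++-identityʳ w)))))
  longerPalindromicPrefix w (b ∷ s) Tv d t r₂ eq 0<t
    with firstReturn (length w) w refl b s Tv d t r₂ eq 0<t
  -- An occurrence at the very start makes `w ∷ʳ b` equal to its reversal `b ∷ reverse w`.
  ... | [] , r′ , eq′ , _ = w ∷ʳ b , s , sym (++-assoc w [ b ] s) , trans wb≡ (sym (reverse-++ w [ b ]))
    , ≤-reflexive (sym (length-∷ʳ w b))
    where
    wb≡ : w ∷ʳ b ≡ b ∷ reverse w
    wb≡ = proj₁ (++-injective (w ∷ʳ b) (b ∷ reverse w) (trans (++-assoc w [ b ] s) eq′)
            (trans (length-∷ʳ w b) (cong suc (sym (length-reverse w)))))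
  -- Otherwise the reversal of `w ∷ʳ b` occurs later, so the argument repeats with this longer
  -- prefix and orientation `true`.
  ... | t′@(_ ∷ _) , r′ , eq′ , _
    with p , q , v≡ , pal , wb<p ←
           longerPalindromicPrefix (w ∷ʳ b) s (subst T (sym (++-assoc w [ b ] s)) Tv) true t′ r′
           (trans (++-assoc w [ b ] s) (trans eq′ (cong (λ v → t′ ++ v ++ r′) (sym (reverse-++ w [ b ])))))
             (s≤s z≤n)
    = p , q , trans (sym (++-assoc w [ b ] s)) v≡ , pal
    , ≤-trans (≤-reflexive (sym (length-∷ʳ w b))) (<⇒≤ wb<p)

  -- Starting from the empty prefix, a palindromic prefix that recurs in `u` is replaced by a longer
  -- one; the remainder `q` shrinks, so the search ends.
  newPalindrome : ∀ {x u} → T (x ∷ u) → ∃[ p ] ∃[ q ] x ∷ u ≡ p ++ q × Palindrome p × ¬ Factor p u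
  newPalindrome {x} {u} Tv = search (suc (length u)) [] (x ∷ u) refl refl ≤-refl
    where
    search : ∀ n p q → x ∷ u ≡ p ++ q → Palindrome p → length q ≤ n →
             ∃[ p ] ∃[ q ] x ∷ u ≡ p ++ q × Palindrome p × ¬ Factor p u
    search n p q v≡ pal q≤n with infix? _≟_ p u
    ... | no  ¬f = p , q , v≡ , pal , ¬f
    ... | yes f
      with t , r , u≡ ← factor⁻ f
      with p′ , q′ , v≡′ , pal′ , p<p′ ←
             longerPalindromicPrefix p q (subst T v≡ Tv) false (x ∷ t) r
               (trans (sym v≡) (cong (x ∷_) u≡)) (s≤s z≤n)
      = continue n q≤n
      where
      q′<q : length q′ < length q
      q′<q with m , refl , q≡ ← ++-split p p′ {q} {q′} v≡′ (<⇒≤ p<p′) =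
        laterOccurrence⇒longer m q′ (trans q≡ (cong (m ++_) (sym (++-identityʳ q′))))
          (properPrefix⇒nonempty p m p<p′)
      continue : ∀ n → length q ≤ n → ∃[ p ] ∃[ q ] x ∷ u ≡ p ++ q × Palindrome p × ¬ Factor p u
      continue zero    q≤n = contradiction (≤-trans q′<q q≤n) λ ()
      continue (suc n) q≤n = search n p′ q′ (trans v≡ v≡′) pal′ (s≤s⁻¹ (≤-trans q′<q q≤n))

  fullWord : ∀ w → T w → FullWord w
  fullWord [] _ =
      [ [] ]
    , [] ∷ []
    , (λ p → mk⇔ (λ { (here refl) → here Prefix.[] , refl }) λ { (here Prefix.[] , _) → here refl })
    , refl
  fullWord (x ∷ u) Tv
    with ps , unique , enumerates , length-ps ←
           fullWord u (factorial (suffix⇒factor [ x ]) Tv)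
    with p , q , v≡ , pal , p∉u ← newPalindrome Tv
    = p ∷ ps
    , All.tabulate (λ { r∈ps refl → p∉u (proj₁ (Equivalence.to (enumerates p) r∈ps)) }) ∷ unique
    , (λ r → mk⇔ (to r) (λ (f , pal-r) → from r f pal-r))
    , cong suc length-ps
    where
    to : ∀ r → r ∈ p ∷ ps → Factor r (x ∷ u) × Palindrome r
    to r (here refl)  = subst (Factor p) (sym v≡) (factor-++ [] q) , pal
    to r (there r∈ps) with f , pal-r ← Equivalence.to (enumerates r) r∈ps = there f , pal-r

    from : ∀ r → Factor r (x ∷ u) → Palindrome r → r ∈ p ∷ ps
    from r f pal-r with ∷⁻ f
    ... | inj₂ r∈u = there (Equivalence.from (enumerates r) (r∈u , pal-r))
    -- A palindromic prefix shorter than `p` recurs in `u`; a longer one would force `p` into `u`.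
    ... | inj₁ prefix with s , v≡′ ← prefix⁻ prefix with <-cmp (length r) (length p)
    ...   | tri< r<p _ _ = there (Equivalence.from (enumerates r)
                        (shorterPalindromicPrefix⇒factor pal pal-r v≡ v≡′ r<p , pal-r))
    ...   | tri≈ _ r≡p _ = here (proj₁ (++-injective r p (trans (sym v≡′) v≡) r≡p))
    ...   | tri> _ _ p<r = contradiction (shorterPalindromicPrefix⇒factor pal-r pal v≡′ v≡ p<r) p∉u

proposition4p24 : ∀ {a ℓ} {A : Set a} (k : ℕ) → A ↔ Fin k →
    (T : Pred (List A) ℓ) →
    Recurrent T → TreeSet₁ T → ClosedUnderReversal T → FullSet T
proposition4p24 k A↔Fin T _ ((factorial , _) , tree) reversal =
  factorial , λ {w} → fullWord (via-injection (↔⇒↣ A↔Fin) Fin._≟_) T (proj₂ factorial) reversal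
                (proj₂ ∘ tree) w
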